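{- Let $h(t)=\sum_{k=0}^n h_k t^k$ be a reciprocal polynomial of degree $n$, and let $\gamma(u)=\sum_{m\ge 0}\gamma_m u^m$ be its gamma polynomial, i.e. the unique polynomial of degree at most $\lfloor n/2\rfloor$ such that $h(t)=(1+t)^n\,\gamma\!\left(\frac{t}{(1+t)^2}\right)$. Then for every integer $m\ge 0$, $$\gamma_m=\sum_{i=0}^m\sum_{\ell=0}^{i} h_\ell\binom{ -n}{i-\ell}\sum_{\substack{j_1+\cdots+j_i=m\\ j_1,\dots,j_i\ge 0}}\widetilde C_{j_1}\cdots\widetilde C_{j_i} =\sum_{i=0}^m\sum_{\ell=0}^{i} h_\ell(-1)^{i-\ell}\binom{n+i-\ell-1}{i-\ell}\sum_{\substack{j_1+\cdots+j_i=m\\ j_1,\dots,j_i\ge 0}}\widetilde C_{j_1}\cdots\widetilde C_{j_i},$$ where $\widetilde C_0=0$ and, for $k\ge 1$, $\widetilde C_k$ is the $k$-th Catalan number. In particular, this sum equals $0$ for $m>\lfloor n/2\rfloor$.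
   Context: A polynomial $h(t)=\sum_{k=0}^n h_kt^k$ of degree $n$ (with, say, real coefficients) is reciprocal if $t^nh(1/t)=h(t)$, i.e. $h_k=h_{n-k}$ for all $k$. For such $h$ a unique polynomial $\gamma$ of degree at most $\lfloor n/2\rfloor$ with $h(t)=(1+t)^n\gamma(t/(1+t)^2)$ exists. The Catalan numbers are $C_k=\frac{1}{k+1}\binom{2k}{k}$. Binomial coefficients are generalized: $\binom{x}{k}=x(x-1)\cdots(x-k+1)/k!$, with $\binom{x}{0}=1$. Conventions: $h_\ell=0$ for $\ell>n$; for $i=0$ the innermost sum is $1$ if $m=0$ (empty product) and $0$ if $m>0$. -}

module Defs where

open import Algebra.Bundles using (CommutativeRing)
open import Data.Integer.Base as ℤ using (ℤ; +_; -[1+_])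
open import Data.Fin.Base using (Fin; zero; suc; toℕ)
open import Data.List.Base as List using (List; []; _∷_; concatMap; upTo)
import Data.Nat.ListAction as ListAction
open import Data.Nat.Base as ℕ using (ℕ; zero; suc; _∸_; _≤_; _<_; _!; ⌊_/2⌋)
open import Data.Nat.Combinatorics using (_C_)
open import Data.Nat.Properties using (_!≢0)
open import Data.Product.Base using (_×_)
open import Data.Vec.Base as Vec using (Vec; []; _∷_)
open import Level using (_⊔_)
open import Relation.Nullary.Negation using (¬_)

-- k + 1 divides the central binomial coefficient, so the division is exact.
catalan : ℕ → ℕ
catalan k = ((2 ℕ.* k) C k) ℕ./ suc k

catalan~ : ℕ → ℕ
catalan~ zero    = 0
catalan~ (suc k) = catalan (suc k)

fallingFactorial : ℤ → ℕ → ℤ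
fallingFactorial x zero    = ℤ.1ℤ
fallingFactorial x (suc k) = fallingFactorial x k ℤ.* (x ℤ.- + k)

-- The integer division is exact: k ! divides any product of k consecutive
-- integers, of either sign.
binomial : ℤ → ℕ → ℤ
binomial x k = (fallingFactorial x k ℤ./ℕ (k !)) {{k !≢0}}

-- All tuples (j₁ , … , jᵢ) of natural numbers with j₁ + ⋯ + jᵢ = m, each
-- listed exactly once.
weakCompositions : (i m : ℕ) → List (Vec ℕ i)
weakCompositions zero    zero    = [] ∷ []
weakCompositions zero    (suc m) = []
weakCompositions (suc i) m       =
  concatMap (λ j → List.map (j ∷_) (weakCompositions i (m ∸ j))) (upTo (suc m))

catalanSum : (i m : ℕ) → ℕ
catalanSum i m =
  ListAction.sum
    (List.map (λ js → ListAction.product (List.map catalan~ (Vec.toList js)))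
              (weakCompositions i m))

module GammaPolynomial {c ℓ} (R : CommutativeRing c ℓ) where
  open CommutativeRing R hiding (zero)
  open import Algebra.Properties.Semiring.Sum semiring
    using (sum; sum⁺-syntax; sum-cong-≋; sum-replicate-zero)
  open import Algebra.Properties.Semiring.Mult semiring
    using () renaming (_×_ to _·_)
  import Relation.Binary.Reasoning.Setoid setoid as ≈-Reasoning

  fromℤ : ℤ → Carrier
  fromℤ (+ k)      = k · 1#
  fromℤ (-[1+ k ]) = - (suc k · 1#)

  -- A finitely supported coefficient sequence; the bound need not be the degree.
  record Polynomial : Set (c ⊔ ℓ) where
    field
      coeff    : ℕ → Carrier
      bound    : ℕ
      vanishes : ∀ k → bound < k → coeff k ≈ 0#

  open Polynomial public

  DegreeAtMost : ℕ → Polynomial → Set ℓ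
  DegreeAtMost d p = ∀ k → d < k → coeff p k ≈ 0#

  HasDegree : ℕ → Polynomial → Set ℓ
  HasDegree n p = DegreeAtMost n p × ¬ (coeff p n ≈ 0#)

  Reciprocal : ℕ → Polynomial → Set ℓ
  Reciprocal n h = ∀ k → k ≤ n → coeff h k ≈ coeff h (n ∸ k)

  -- The identity defining γ involves rational functions whose denominators
  -- are powers of 1 + t.  As 1 + t has constant term 1, such functions embed
  -- in the formal power series R⟦t⟧, and the identity is stated there.
  Series : Set c
  Series = ℕ → Carrier

  infix  4 _≈ₛ_
  infixl 7 _*ₛ_
  infixr 8 _^ₛ_

  _≈ₛ_ : Series → Series → Set ℓ
  f ≈ₛ g = ∀ k → f k ≈ g k

  _*ₛ_ : Series → Series → Series
  (f *ₛ g) k = ∑[ i ≤ k ] (f (toℕ i) * g (k ∸ toℕ i))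

  1ₛ : Series
  1ₛ zero    = 1#
  1ₛ (suc _) = 0#

  _^ₛ_ : Series → ℕ → Series
  f ^ₛ zero  = 1ₛ
  f ^ₛ suc k = f *ₛ f ^ₛ k

  t : Series
  t (suc zero) = 1#
  t _          = 0#

  1+t : Series
  1+t k = 1ₛ k + t k

  1/[1+t] : Series
  1/[1+t] zero    = 1#
  1/[1+t] (suc k) = - (1/[1+t] k)

  1+t-inverseʳ : 1+t *ₛ 1/[1+t] ≈ₛ 1ₛ
  1+t-inverseʳ zero = begin
    (1# + 0#) * 1# + 0#  ≈⟨ +-identityʳ _ ⟩
    (1# + 0#) * 1#       ≈⟨ *-identityʳ _ ⟩
    1# + 0#              ≈⟨ +-identityʳ _ ⟩
    1#                   ∎
    where open ≈-Reasoning
  1+t-inverseʳ (suc k) = begin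
    (1# + 0#) * - x + ((0# + 1#) * x + ∑rest)
      ≈⟨ +-cong (*-congʳ (+-identityʳ 1#)) (+-cong (*-congʳ (+-identityˡ 1#)) ∑rest≈0) ⟩
    1# * - x + (1# * x + 0#)
      ≈⟨ +-cong (*-identityˡ _) (trans (+-identityʳ _) (*-identityˡ _)) ⟩
    - x + x
      ≈⟨ -‿inverseˡ x ⟩
    0# ∎
    where
    open ≈-Reasoning
    x = 1/[1+t] k
    rest : Fin k → Carrier
    rest i = (0# + 0#) * 1/[1+t] (suc k ∸ toℕ (suc (suc i)))
    ∑rest = sum rest
    ∑rest≈0 : ∑rest ≈ 0#
    ∑rest≈0 = trans
      (sum-cong-≋ {x = rest} {y = λ _ → 0#}
        (λ _ → trans (*-congʳ (+-identityʳ 0#)) (zeroˡ _)))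
      (sum-replicate-zero k)

  -- Composition p(f).
  _⟨_⟩ : Polynomial → Series → Series
  (p ⟨ f ⟩) k = ∑[ i ≤ bound p ] (coeff p (toℕ i) * (f ^ₛ toℕ i) k)

  IsGammaPolynomial : ℕ → Polynomial → Polynomial → Set ℓ
  IsGammaPolynomial n h γ =
    DegreeAtMost ⌊ n /2⌋ γ ×
    coeff h ≈ₛ 1+t ^ₛ n *ₛ γ ⟨ t *ₛ 1/[1+t] ^ₛ 2 ⟩

  gammaSum : ℕ → Polynomial → ℕ → Carrier
  gammaSum n h m =
    ∑[ i ≤ m ] ∑[ l ≤ toℕ i ]
      ( coeff h (toℕ l)
      * fromℤ (binomial (ℤ.- + n) (toℕ i ∸ toℕ l))
      * fromℤ (+ catalanSum (toℕ i) m) )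

  gammaSum′ : ℕ → Polynomial → ℕ → Carrier
  gammaSum′ n h m =
    ∑[ i ≤ m ] ∑[ l ≤ toℕ i ]
      ( coeff h (toℕ l)
      * fromℤ (ℤ.-1ℤ ℤ.^ (toℕ i ∸ toℕ l))
      * fromℤ (binomial (+ n ℤ.+ + toℕ i ℤ.- + toℕ l ℤ.- + 1) (toℕ i ∸ toℕ l))
      * fromℤ (+ catalanSum (toℕ i) m) )

-- Let C̃ = Σ_{k ≥ 1} C_k u^k; then C̃ = u (1 + C̃)², so C̃ is the compositional
-- inverse of w = t / (1 + t)².  Hence γ(w) = (1 + t)^-n h(t) gives
-- γ(u) = Σᵢ [tⁱ]((1 + t)^-n h(t)) C̃(u)ⁱ.  Substituting C̃ for t is treated as a
-- linear operation on coefficients: the equation for C̃ says that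
-- multiplication by t before substituting agrees with multiplication by
-- (1 + t)² before substituting and by u afterwards, which sends w^k to u^k by
-- induction on k, without multiplicativity of the substitution.

module Submission where

open import Defs
open import Algebra.Bundles using (CommutativeRing)
open import Data.Fin.Base using (toℕ)
open import Data.Fin.Properties using (toℕ≤pred[n])
open import Data.Integer.Base as ℤ using (ℤ; +_; -[1+_])
import Data.Integer.Properties as ℤ
open import Data.Nat.Base as ℕ using (ℕ; zero; suc; _∸_; _≤_; _<_; z<s; s<s; NonZero; _!; ⌊_/2⌋)
open import Data.Nat.DivMod using (m*n/n≡m; m*n%n≡0; /-congˡ)
import Data.Nat.Properties as ℕ
open import Data.Product.Base using (_×_; _,_)
open import Function.Base using (_∘_)
open import Relation.Binary.PropositionalEquality as ≡ using (_≡_)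

-- Coefficients of the powers of the Catalan series.

module Ballot where

  open import Data.List.Base as List using (List; []; _∷_; _++_; applyUpTo; upTo; concatMap)
  import Data.List.Properties as List
  import Data.Nat.ListAction as ListAction
  import Data.Nat.ListAction.Properties as ListAction
  open import Data.Nat.Base using (_+_; _*_)
  open import Data.Nat.Combinatorics using (_C_; nC1≡n; nCk≡nC[n∸k]; nCk+nC[k+1]≡[n+1]C[k+1])
  open import Data.Nat.Tactic.RingSolver using (solve-∀)
  open import Data.Vec.Base as Vec using (Vec; _∷_)
  open ≡ using (refl; sym; trans; cong; cong₂; module ≡-Reasoning)

  -- The recurrence is that of the coefficients of C̃ⁱ, where C̃ = u (1 + C̃)².
  ballot : (i m : ℕ) → ℕ
  ballot zero    zero    = 1
  ballot zero    (suc m) = 0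
  ballot (suc i) zero    = 0
  ballot (suc i) (suc m) =
    (ballot i m + ballot (suc i) m) + (ballot (suc i) m + ballot (suc (suc i)) m)

  -- C̃ has no constant term, so C̃ⁱ has no terms below degree i. This later removes the boundary
  -- terms of sums over i cut off at m.
  ballot-vanishes : ∀ {i m} → m < i → ballot i m ≡ 0
  ballot-vanishes {suc i} {zero}  _         = refl
  ballot-vanishes {suc i} {suc m} (s<s m<i)
    rewrite ballot-vanishes m<i
          | ballot-vanishes (ℕ.m<n⇒m<1+n m<i)
          | ballot-vanishes (ℕ.m<n⇒m<1+n (ℕ.m<n⇒m<1+n m<i)) = refl

  -- Ballot numbers as differences of binomial coefficients.

  pascal² : ∀ n k → suc (suc n) C suc (suc k) ≡
            (n C k + n C suc k) + (n C suc k + n C suc (suc k))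
  pascal² n k = sym (trans
    (cong₂ _+_ (nCk+nC[k+1]≡[n+1]C[k+1] n k) (nCk+nC[k+1]≡[n+1]C[k+1] n (suc k)))
    (nCk+nC[k+1]≡[n+1]C[k+1] (suc n) (suc k)))

  -- The absorption identity, usually written with the factor n - k on the right; moving k to the
  -- left avoids truncated subtraction.
  C-absorb : ∀ n k → suc k * (n C suc k) + k * (n C k) ≡ n * (n C k)
  C-absorb n       zero    = begin
    1 * (n C 1) + 0  ≡⟨ ℕ.+-identityʳ _ ⟩
    1 * (n C 1)      ≡⟨ cong (1 *_) (nC1≡n n) ⟩
    1 * n            ≡⟨ ℕ.*-comm 1 n ⟩
    n * 1            ∎
    where open ≡-Reasoning
  C-absorb zero    (suc k) = cong₂ _+_ (ℕ.*-zeroʳ k) (ℕ.*-zeroʳ k)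
  C-absorb (suc n) (suc k)
    rewrite sym (nCk+nC[k+1]≡[n+1]C[k+1] n k)
          | sym (nCk+nC[k+1]≡[n+1]C[k+1] n (suc k)) = begin
    (2 + k) * (y + z) + suc k * (x + y)
      ≡⟨ regroup k x y z ⟩
    (suc k * y + k * x) + ((2 + k) * z + suc k * y) + (x + y)
      ≡⟨ cong (_+ (x + y)) (cong₂ _+_ (C-absorb n k) (C-absorb n (suc k))) ⟩
    (n * x + n * y) + (x + y)
      ≡⟨ collect n x y ⟩
    suc n * (x + y) ∎
    where
    open ≡-Reasoning
    x = n C k
    y = n C suc k
    z = n C suc (suc k)
    regroup : ∀ k x y z → (2 + k) * (y + z) + suc k * (x + y) ≡
              (suc k * y + k * x) + ((2 + k) * z + suc k * y) + (x + y)
    regroup = solve-∀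
    collect : ∀ n x y → (n * x + n * y) + (x + y) ≡ suc n * (x + y)
    collect = solve-∀

  C-middle : ∀ m → suc (m + m) C suc m ≡ suc (m + m) C m
  C-middle m = sym (trans
    (nCk≡nC[n∸k] (ℕ.≤-trans (ℕ.m≤m+n m m) (ℕ.n≤1+n _)))
    (cong (suc (m + m) C_) (ℕ.m+n∸n≡m (suc m) m)))

  -- The reflection formula for ballot numbers, free of subtraction. Two applications of Pascal's
  -- rule give the difference of adjacent binomials the same recurrence as `ballot`; at `i = 0` the
  -- two middle entries of an odd row agree.
  ballot-C : ∀ i m → ballot i (suc m) + suc (m + m) C suc (m + i) ≡ suc (m + m) C (m + i)
  ballot-C zero          m       rewrite ℕ.+-identityʳ m = C-middle m
  ballot-C (suc zero)    zero    = refl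
  ballot-C (suc (suc i)) zero    = refl
  ballot-C (suc i)       (suc m)
    rewrite ℕ.+-suc m m | ℕ.+-suc m i
          | pascal² (suc (m + m)) (suc (m + i)) | pascal² (suc (m + m)) (m + i) = begin
    ((a + b) + (b + c)) + ((y + z) + (z + w))  ≡⟨ regroup a b c y z w ⟩
    ((a + y) + (b + z)) + ((b + z) + (c + w))  ≡⟨ cong₂ _+_ (cong₂ _+_ p q) (cong₂ _+_ q r) ⟩
    (x + y) + (y + z)                          ∎
    where
    open ≡-Reasoning
    a = ballot i (suc m)
    b = ballot (suc i) (suc m)
    c = ballot (suc (suc i)) (suc m)
    x = suc (m + m) C (m + i)
    y = suc (m + m) C suc (m + i)
    z = suc (m + m) C suc (suc (m + i))
    w = suc (m + m) C suc (suc (suc (m + i)))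
    p : a + y ≡ x
    p = ballot-C i m
    q : b + z ≡ y
    q = ≡.subst (λ k → b + suc (m + m) C suc k ≡ suc (m + m) C k) (ℕ.+-suc m i) (ballot-C (suc i) m)
    r : c + w ≡ z
    r = ≡.subst (λ k → c + suc (m + m) C suc k ≡ suc (m + m) C k)
          (trans (ℕ.+-suc m (suc i)) (cong suc (ℕ.+-suc m i))) (ballot-C (suc (suc i)) m)
    regroup : ∀ a b c y z w → ((a + b) + (b + c)) + ((y + z) + (z + w)) ≡
              ((a + y) + (b + z)) + ((b + z) + (c + w))
    regroup = solve-∀

  ballot-1-C : ∀ m → ballot 1 (suc m) * (2 + m) ≡ (2 * suc m) C suc m
  ballot-1-C m = begin
    -- The added term is the left side of the absorption identity for `n` and `suc m`, so it can be
    -- traded for `n * x` and then cancelled.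
    b * (2 + m)                 ≡⟨ ℕ.+-cancelʳ-≡ ((2 + m) * y + suc m * x) _ _ scaled ⟩
    x + x                       ≡⟨ cong (_+ x) (C-middle m) ⟩
    n C m + n C suc m           ≡⟨ nCk+nC[k+1]≡[n+1]C[k+1] n m ⟩
    suc n C suc m               ≡⟨ cong (_C suc m) (double m) ⟩
    (2 * suc m) C suc m         ∎
    where
    open ≡-Reasoning
    n = suc (m + m)
    b = ballot 1 (suc m)
    x = n C suc m
    y = n C suc (suc m)
    b+y≡x : b + y ≡ x
    b+y≡x = ≡.subst (λ k → b + n C suc k ≡ n C k) (ℕ.+-comm m 1) (ballot-C 1 m)
    double : ∀ m → suc (suc (m + m)) ≡ 2 * suc m
    double = solve-∀
    expand : ∀ m b y x → b * (2 + m) + ((2 + m) * y + suc m * x) ≡ (2 + m) * (b + y) + suc m * x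
    expand = solve-∀
    collect : ∀ m x → (2 + m) * x + suc m * x ≡ (x + x) + suc (m + m) * x
    collect = solve-∀
    scaled : b * (2 + m) + ((2 + m) * y + suc m * x) ≡ (x + x) + ((2 + m) * y + suc m * x)
    scaled = begin
      b * (2 + m) + ((2 + m) * y + suc m * x)  ≡⟨ expand m b y x ⟩
      (2 + m) * (b + y) + suc m * x            ≡⟨ cong (λ s → (2 + m) * s + suc m * x) b+y≡x ⟩
      (2 + m) * x + suc m * x                  ≡⟨ collect m x ⟩
      (x + x) + n * x                          ≡⟨ cong (_+_ (x + x)) (C-absorb n (suc m)) ⟨
      (x + x) + ((2 + m) * y + suc m * x)      ∎

  -- Ties the recurrence to the Catalan numbers: since `ballot 1 (suc m)` times m + 2 is the central
  -- binomial, the division in `catalan` is exact and returns it.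
  ballot-1 : ∀ m → ballot 1 m ≡ catalan~ m
  ballot-1 zero    = refl
  ballot-1 (suc m) = trans
    (sym (m*n/n≡m (ballot 1 (suc m)) (2 + m)))
    (/-congˡ (ballot-1-C m))

  -- Convolution of sequences of natural numbers.

  convolution : (f g : ℕ → ℕ) → ℕ → ℕ
  convolution f g zero    = f 0 * g 0
  convolution f g (suc m) = f 0 * g (suc m) + convolution (f ∘ suc) g m

  convolution-congʳ : ∀ f {g h} → (∀ k → g k ≡ h k) → ∀ m → convolution f g m ≡ convolution f h m
  convolution-congʳ f g≗h zero    = cong (f 0 *_) (g≗h 0)
  convolution-congʳ f g≗h (suc m) =
    cong₂ _+_ (cong (f 0 *_) (g≗h (suc m))) (convolution-congʳ (f ∘ suc) g≗h m)

  convolution-sucʳ : ∀ f g m → convolution f g (suc m) ≡ convolution f (g ∘ suc) m + f (suc m) * g 0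
  convolution-sucʳ f g zero    = refl
  convolution-sucʳ f g (suc m) = trans
    (cong (_+_ (f 0 * g (suc (suc m)))) (convolution-sucʳ (f ∘ suc) g m))
    (sym (ℕ.+-assoc (f 0 * g (suc (suc m))) _ _))

  convolution-+ʳ : ∀ f g h m →
    convolution f (λ k → g k + h k) m ≡ convolution f g m + convolution f h m
  convolution-+ʳ f g h zero    = ℕ.*-distribˡ-+ (f 0) (g 0) (h 0)
  convolution-+ʳ f g h (suc m) = trans
    (cong (_+_ (f 0 * (g (suc m) + h (suc m)))) (convolution-+ʳ (f ∘ suc) g h m))
    (regroup (f 0) (g (suc m)) (h (suc m)) _ _)
    where
    regroup : ∀ a x y p q → a * (x + y) + (p + q) ≡ (a * x + p) + (a * y + q)
    regroup = solve-∀

  convolution-identityʳ : ∀ f m → convolution f (ballot 0) m ≡ f m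
  convolution-identityʳ f zero    = ℕ.*-identityʳ (f 0)
  convolution-identityʳ f (suc m) =
    cong₂ _+_ (ℕ.*-zeroʳ (f 0)) (convolution-identityʳ (f ∘ suc) m)

  -- Both sides satisfy the recurrence of ballot, so no Catalan convolution
  -- identity is needed.
  ballot-convolution : ∀ i m → convolution catalan~ (ballot i) m ≡ ballot (suc i) m
  ballot-convolution zero    m       = trans (convolution-identityʳ catalan~ m) (sym (ballot-1 m))
  ballot-convolution (suc i) zero    = refl
  ballot-convolution (suc i) (suc m) = begin
    convolution c (ballot (suc i)) (suc m)
      -- The last term carries the factor `ballot (suc i) 0`, which is 0; what remains evaluates
      -- `ballot (suc i)` only at successors, where its recurrence unfolds.
      ≡⟨ convolution-sucʳ c (ballot (suc i)) m ⟩
    convolution c (ballot (suc i) ∘ suc) m + c (suc m) * 0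
      ≡⟨ cong (_+_ (convolution c (ballot (suc i) ∘ suc) m)) (ℕ.*-zeroʳ (c (suc m))) ⟩
    convolution c (ballot (suc i) ∘ suc) m + 0
      ≡⟨ ℕ.+-identityʳ _ ⟩
    convolution c (ballot (suc i) ∘ suc) m
      ≡⟨ trans (convolution-+ʳ c (λ k → ballot i k + ballot (suc i) k) _ m)
               (cong₂ _+_ (convolution-+ʳ c (ballot i) _ m) (convolution-+ʳ c (ballot (suc i)) _ m)) ⟩
    (convolution c (ballot i) m + convolution c (ballot (suc i)) m) +
    (convolution c (ballot (suc i)) m + convolution c (ballot (suc (suc i))) m)
      ≡⟨ cong₂ _+_ (cong₂ _+_ (ballot-convolution i m) (ballot-convolution (suc i) m))
                   (cong₂ _+_ (ballot-convolution (suc i) m) (ballot-convolution (suc (suc i)) m)) ⟩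
    ballot (suc (suc i)) (suc m) ∎
    where
    open ≡-Reasoning
    c = catalan~

  -- Sums over weak compositions.

  sum-map-concatMap : ∀ {A B : Set} (f : B → ℕ) (g : A → List B) xs →
    ListAction.sum (List.map f (concatMap g xs)) ≡
    ListAction.sum (List.map (λ x → ListAction.sum (List.map f (g x))) xs)
  sum-map-concatMap f g []       = refl
  sum-map-concatMap f g (x ∷ xs) = begin
    ListAction.sum (List.map f (g x ++ concatMap g xs))
      ≡⟨ cong ListAction.sum (List.map-++ f (g x) _) ⟩
    ListAction.sum (List.map f (g x) ++ List.map f (concatMap g xs))
      ≡⟨ ListAction.sum-++ (List.map f (g x)) _ ⟩
    ListAction.sum (List.map f (g x)) + ListAction.sum (List.map f (concatMap g xs))
      ≡⟨ cong (_+_ (ListAction.sum (List.map f (g x)))) (sum-map-concatMap f g xs) ⟩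
    ListAction.sum (List.map (λ x → ListAction.sum (List.map f (g x))) (x ∷ xs)) ∎
    where open ≡-Reasoning

  sum-map-* : ∀ {A : Set} a (f : A → ℕ) xs →
    ListAction.sum (List.map (λ x → a * f x) xs) ≡ a * ListAction.sum (List.map f xs)
  sum-map-* a f []       = sym (ℕ.*-zeroʳ a)
  sum-map-* a f (x ∷ xs) = trans
    (cong (_+_ (a * f x)) (sum-map-* a f xs))
    (sym (ℕ.*-distribˡ-+ a (f x) _))

  sum-applyUpTo≡convolution : ∀ f g m →
    ListAction.sum (applyUpTo (λ j → f j * g (m ∸ j)) (suc m)) ≡ convolution f g m
  sum-applyUpTo≡convolution f g zero    = ℕ.+-identityʳ _
  sum-applyUpTo≡convolution f g (suc m) =
    cong (_+_ (f 0 * g (suc m))) (sum-applyUpTo≡convolution (f ∘ suc) g m)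

  -- Compositions are grouped by their first part j: the factor `catalan~ j` comes out, and the
  -- other parts form a composition of m - j.
  catalanSum-suc : ∀ i m → catalanSum (suc i) m ≡ convolution catalan~ (catalanSum i) m
  catalanSum-suc i m = begin
    catalanSum (suc i) m
      ≡⟨ sum-map-concatMap weight (λ j → List.map (j ∷_) (weakCompositions i (m ∸ j))) (upTo (suc m)) ⟩
    ListAction.sum (List.map (λ j → ListAction.sum (List.map weight
      (List.map (j ∷_) (weakCompositions i (m ∸ j))))) (upTo (suc m)))
      ≡⟨ cong ListAction.sum (List.map-cong first-part (upTo (suc m))) ⟩
    ListAction.sum (List.map (λ j → catalan~ j * catalanSum i (m ∸ j)) (upTo (suc m)))
      ≡⟨ cong ListAction.sum (List.map-upTo (λ j → catalan~ j * catalanSum i (m ∸ j)) (suc m)) ⟩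
    ListAction.sum (applyUpTo (λ j → catalan~ j * catalanSum i (m ∸ j)) (suc m))
      ≡⟨ sum-applyUpTo≡convolution catalan~ (catalanSum i) m ⟩
    convolution catalan~ (catalanSum i) m ∎
    where
    open ≡-Reasoning
    weight : ∀ {i} → Vec ℕ i → ℕ
    weight js = ListAction.product (List.map catalan~ (Vec.toList js))
    first-part : ∀ j →
      ListAction.sum (List.map weight (List.map (j ∷_) (weakCompositions i (m ∸ j)))) ≡
      catalan~ j * catalanSum i (m ∸ j)
    first-part j = trans
      (cong ListAction.sum (sym (List.map-∘ (weakCompositions i (m ∸ j)))))
      (sum-map-* (catalan~ j) weight (weakCompositions i (m ∸ j)))

  -- Both are iterated convolutions with `catalan~`, starting from the unit at `i = 0`.
  catalanSum≡ballot : ∀ i m → catalanSum i m ≡ ballot i m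
  catalanSum≡ballot zero    zero    = refl
  catalanSum≡ballot zero    (suc m) = refl
  catalanSum≡ballot (suc i) m       = begin
    catalanSum (suc i) m                   ≡⟨ catalanSum-suc i m ⟩
    convolution catalan~ (catalanSum i) m  ≡⟨ convolution-congʳ catalan~ (catalanSum≡ballot i) m ⟩
    convolution catalan~ (ballot i) m      ≡⟨ ballot-convolution i m ⟩
    ballot (suc i) m                       ∎
    where open ≡-Reasoning

-- Binomial coefficients with integer upper index.

module IntegerBinomial where

  open import Data.Integer.Tactic.RingSolver using (solve-∀)
  open import Data.Nat.Base using (_+_; _*_)
  open import Data.Nat.Properties using (_!≢0)
  open ≡ using (refl; sym; trans; cong; cong₂; module ≡-Reasoning)

  -- The multiset coefficient with upper index n + k - 1 and lower index k, given by its Pascal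
  -- recurrence so that n = k = 0 involves no truncated subtraction.
  multichoose : (n k : ℕ) → ℕ
  multichoose n       zero    = 1
  multichoose zero    (suc k) = 0
  multichoose (suc n) (suc k) = multichoose (suc n) k + multichoose n (suc k)

  risingFactorial : ℤ → ℕ → ℤ
  risingFactorial x zero    = ℤ.1ℤ
  risingFactorial x (suc k) = risingFactorial x k ℤ.* (x ℤ.+ + k)

  risingFactorial-suc : ∀ x k →
    risingFactorial x (suc k) ≡ x ℤ.* risingFactorial (x ℤ.+ ℤ.1ℤ) k
  risingFactorial-suc x zero    = lem x
    where
    lem : ∀ x → ℤ.1ℤ ℤ.* (x ℤ.+ + 0) ≡ x ℤ.* ℤ.1ℤ
    lem = solve-∀
  risingFactorial-suc x (suc k) = begin
    risingFactorial x (suc k) ℤ.* (x ℤ.+ + suc k)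
      ≡⟨ cong (ℤ._* (x ℤ.+ + suc k)) (risingFactorial-suc x k) ⟩
    x ℤ.* r ℤ.* (x ℤ.+ (ℤ.1ℤ ℤ.+ + k))
      ≡⟨ regroup x r (+ k) ⟩
    x ℤ.* (r ℤ.* (x ℤ.+ ℤ.1ℤ ℤ.+ + k)) ∎
    where
    open ≡-Reasoning
    r = risingFactorial (x ℤ.+ ℤ.1ℤ) k
    regroup : ∀ x r k → x ℤ.* r ℤ.* (x ℤ.+ (ℤ.1ℤ ℤ.+ k)) ≡ x ℤ.* (r ℤ.* (x ℤ.+ ℤ.1ℤ ℤ.+ k))
    regroup = solve-∀

  fallingFactorial-suc : ∀ x k →
    fallingFactorial x (suc k) ≡ x ℤ.* fallingFactorial (x ℤ.- ℤ.1ℤ) k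
  fallingFactorial-suc x zero    = lem x
    where
    lem : ∀ x → ℤ.1ℤ ℤ.* (x ℤ.- + 0) ≡ x ℤ.* ℤ.1ℤ
    lem = solve-∀
  fallingFactorial-suc x (suc k) = begin
    fallingFactorial x (suc k) ℤ.* (x ℤ.- + suc k)
      ≡⟨ cong (ℤ._* (x ℤ.- + suc k)) (fallingFactorial-suc x k) ⟩
    x ℤ.* r ℤ.* (x ℤ.- (ℤ.1ℤ ℤ.+ + k))
      ≡⟨ regroup x r (+ k) ⟩
    x ℤ.* (r ℤ.* (x ℤ.- ℤ.1ℤ ℤ.- + k)) ∎
    where
    open ≡-Reasoning
    r = fallingFactorial (x ℤ.- ℤ.1ℤ) k
    regroup : ∀ x r k → x ℤ.* r ℤ.* (x ℤ.- (ℤ.1ℤ ℤ.+ k)) ≡ x ℤ.* (r ℤ.* (x ℤ.- ℤ.1ℤ ℤ.- k))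
    regroup = solve-∀

  fallingFactorial-neg : ∀ x k →
    fallingFactorial (ℤ.- x) k ≡ ℤ.-1ℤ ℤ.^ k ℤ.* risingFactorial x k
  fallingFactorial-neg x zero    = refl
  fallingFactorial-neg x (suc k) = trans
    (cong (ℤ._* (ℤ.- x ℤ.- + k)) (fallingFactorial-neg x k))
    (regroup (ℤ.-1ℤ ℤ.^ k) (risingFactorial x k) x (+ k))
    where
    regroup : ∀ s r x k → s ℤ.* r ℤ.* (ℤ.- x ℤ.- k) ≡ ℤ.-1ℤ ℤ.* s ℤ.* (r ℤ.* (x ℤ.+ k))
    regroup = solve-∀

  -- The same k consecutive factors, read from the top down.
  fallingFactorial-rising : ∀ x k → fallingFactorial (x ℤ.+ + k ℤ.- ℤ.1ℤ) k ≡ risingFactorial x k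
  fallingFactorial-rising x zero    = refl
  fallingFactorial-rising x (suc k) = begin
    fallingFactorial (x ℤ.+ + suc k ℤ.- ℤ.1ℤ) (suc k)
      ≡⟨ cong (λ y → fallingFactorial y (suc k)) (cancel x (+ k)) ⟩
    fallingFactorial (x ℤ.+ + k) (suc k)
      ≡⟨ fallingFactorial-suc (x ℤ.+ + k) k ⟩
    (x ℤ.+ + k) ℤ.* fallingFactorial (x ℤ.+ + k ℤ.- ℤ.1ℤ) k
      ≡⟨ cong ((x ℤ.+ + k) ℤ.*_) (fallingFactorial-rising x k) ⟩
    (x ℤ.+ + k) ℤ.* risingFactorial x k
      ≡⟨ ℤ.*-comm (x ℤ.+ + k) _ ⟩
    risingFactorial x (suc k) ∎
    where
    open ≡-Reasoning
    cancel : ∀ x k → x ℤ.+ (ℤ.1ℤ ℤ.+ k) ℤ.- ℤ.1ℤ ≡ x ℤ.+ k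
    cancel = solve-∀

  multichoose-! : ∀ n k → risingFactorial (+ n) k ≡ + multichoose n k ℤ.* + (k !)
  multichoose-! n       zero    = refl
  multichoose-! zero    (suc k) = risingFactorial-suc (+ 0) k
  multichoose-! (suc n) (suc k) = begin
    risingFactorial (+ suc n) k ℤ.* (+ suc n ℤ.+ + k)
      -- The last factor n + 1 + k is split as (k + 1) + n, and the two halves match the two
      -- summands of the recurrence of `multichoose`.
      ≡⟨ split (risingFactorial (+ suc n) k) (+ n) (+ k) ⟩
    (ℤ.1ℤ ℤ.+ + k) ℤ.* risingFactorial (+ suc n) k ℤ.+ + n ℤ.* risingFactorial (+ suc n) k
      ≡⟨ cong₂ ℤ._+_ (cong ((ℤ.1ℤ ℤ.+ + k) ℤ.*_) (multichoose-! (suc n) k)) lower ⟩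
    + suc k ℤ.* (+ a ℤ.* + (k !)) ℤ.+ + b ℤ.* + (suc k !)
      ≡⟨ cong (λ z → + suc k ℤ.* (+ a ℤ.* + (k !)) ℤ.+ + b ℤ.* z) (ℤ.pos-* (suc k) (k !)) ⟩
    + suc k ℤ.* (+ a ℤ.* + (k !)) ℤ.+ + b ℤ.* (+ suc k ℤ.* + (k !))
      ≡⟨ collect (+ suc k) (+ a) (+ b) (+ (k !)) ⟩
    (+ a ℤ.+ + b) ℤ.* (+ suc k ℤ.* + (k !))
      ≡⟨ cong ((+ a ℤ.+ + b) ℤ.*_) (ℤ.pos-* (suc k) (k !)) ⟨
    + multichoose (suc n) (suc k) ℤ.* + (suc k !) ∎
    where
    open ≡-Reasoning
    a = multichoose (suc n) k
    b = multichoose n (suc k)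
    lower : + n ℤ.* risingFactorial (+ suc n) k ≡ + b ℤ.* + (suc k !)
    lower = begin
      + n ℤ.* risingFactorial (+ suc n) k
        ≡⟨ cong (λ z → + n ℤ.* risingFactorial (+ z) k) (ℕ.+-comm 1 n) ⟩
      + n ℤ.* risingFactorial (+ n ℤ.+ ℤ.1ℤ) k
        ≡⟨ risingFactorial-suc (+ n) k ⟨
      risingFactorial (+ n) (suc k)
        ≡⟨ multichoose-! n (suc k) ⟩
      + b ℤ.* + (suc k !) ∎
    split : ∀ r n k → r ℤ.* (ℤ.1ℤ ℤ.+ n ℤ.+ k) ≡ (ℤ.1ℤ ℤ.+ k) ℤ.* r ℤ.+ n ℤ.* r
    split = solve-∀
    collect : ∀ s a b f → s ℤ.* (a ℤ.* f) ℤ.+ b ℤ.* (s ℤ.* f) ≡ (a ℤ.+ b) ℤ.* (s ℤ.* f)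
    collect = solve-∀

  i*d/ℕd≡i : ∀ i d .{{_ : NonZero d}} → (i ℤ.* + d) ℤ./ℕ d ≡ i
  i*d/ℕd≡i (+ n)    d       = trans
    (cong (ℤ._/ℕ d) (sym (ℤ.pos-* n d)))
    (cong +_ (m*n/n≡m n d))
  -- On a negative integer `/ℕ` branches on the remainder; its vanishing excludes the branch that
  -- rounds down.
  i*d/ℕd≡i -[1+ n ] (suc d) with (suc n * suc d) ℕ.% suc d | m*n%n≡0 (suc n) (suc d)
  ... | zero | _ = cong (λ z → ℤ.- (+ z)) (m*n/n≡m (suc n) (suc d))

  -- Upper negation: the falling factorial of -n is a signed rising factorial, hence an explicit
  -- multiple of `k !`, and the integer division is exact.
  binomial-neg : ∀ n k → binomial (ℤ.- + n) k ≡ ℤ.-1ℤ ℤ.^ k ℤ.* + multichoose n k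
  binomial-neg n k = trans (cong (λ x → (x ℤ./ℕ (k !)) {{k !≢0}}) eq) (i*d/ℕd≡i _ (k !) {{k !≢0}})
    where
    open ≡-Reasoning
    eq : fallingFactorial (ℤ.- + n) k ≡ (ℤ.-1ℤ ℤ.^ k ℤ.* + multichoose n k) ℤ.* + (k !)
    eq = begin
      fallingFactorial (ℤ.- + n) k                         ≡⟨ fallingFactorial-neg (+ n) k ⟩
      ℤ.-1ℤ ℤ.^ k ℤ.* risingFactorial (+ n) k              ≡⟨ cong (ℤ.-1ℤ ℤ.^ k ℤ.*_) (multichoose-! n k) ⟩
      ℤ.-1ℤ ℤ.^ k ℤ.* (+ multichoose n k ℤ.* + (k !))      ≡⟨ ℤ.*-assoc (ℤ.-1ℤ ℤ.^ k) _ _ ⟨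
      (ℤ.-1ℤ ℤ.^ k ℤ.* + multichoose n k) ℤ.* + (k !)      ∎

  binomial-pos : ∀ n k → binomial (+ n ℤ.+ + k ℤ.- ℤ.1ℤ) k ≡ + multichoose n k
  binomial-pos n k = trans
    (cong (λ x → (x ℤ./ℕ (k !)) {{k !≢0}}) (trans (fallingFactorial-rising (+ n) k) (multichoose-! n k)))
    (i*d/ℕd≡i _ (k !) {{k !≢0}})

-- Formal power series over a commutative ring.

module PowerSeries {c ℓ} (R : CommutativeRing c ℓ) where

  open Ballot using (ballot; ballot-vanishes; catalanSum≡ballot)
  open IntegerBinomial using (multichoose; binomial-neg; binomial-pos)
  open CommutativeRing R hiding (zero)
  open GammaPolynomial R
  open import Algebra.Properties.AbelianGroup +-abelianGroup
    using (ε⁻¹≈ε; ⁻¹-involutive)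
  open import Algebra.Properties.Ring ring using (-‿distribˡ-*)
  open import Algebra.Properties.Semiring.Mult semiring
    using (×-homo-+; ×-congˡ; ×-homo-1) renaming (_×_ to _·_)
  open import Algebra.Properties.Semiring.Sum semiring
    using (sum-syntax; sum⁺-syntax; sum-cong-≋; sum-replicate-zero; ∑-comm; ∑-distrib-+;
           *-distribˡ-sum; *-distribʳ-sum)
  open import Relation.Binary.Reasoning.Setoid setoid

  infixl 6 _+ₛ_
  infixr 8 t·_ [1+t]·_ [1+t]^_·_

  _+ₛ_ : Series → Series → Series
  (f +ₛ g) k = f k + g k

  -- Multiplication by t, encoded as a shift of coefficients. This operator and `[1+t]·_` pass
  -- through either factor of `*ₛ`, which carries the algebra below.
  t·_ : Series → Series
  (t· f) zero    = 0#
  (t· f) (suc k) = f k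

  [1+t]·_ : Series → Series
  [1+t]· f = f +ₛ t· f

  [1+t]^_·_ : ℕ → Series → Series
  [1+t]^ zero  · f = f
  [1+t]^ suc n · f = [1+t]· [1+t]^ n · f

  ≈ₛ-sym : ∀ {f g} → f ≈ₛ g → g ≈ₛ f
  ≈ₛ-sym f≈g k = sym (f≈g k)

  ≈ₛ-trans : ∀ {f g h} → f ≈ₛ g → g ≈ₛ h → f ≈ₛ h
  ≈ₛ-trans f≈g g≈h k = trans (f≈g k) (g≈h k)

  t·-cong : ∀ {f g} → f ≈ₛ g → t· f ≈ₛ t· g
  t·-cong f≈g zero    = refl
  t·-cong f≈g (suc k) = f≈g k

  [1+t]·-cong : ∀ {f g} → f ≈ₛ g → [1+t]· f ≈ₛ [1+t]· g
  [1+t]·-cong f≈g k = +-cong (f≈g k) (t·-cong f≈g k)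

  ∑-zeroˡ : ∀ n (g : ℕ → Carrier) → ∑[ i < n ] (0# * g (toℕ i)) ≈ 0#
  ∑-zeroˡ n g = trans (sum-cong-≋ {n} (λ i → zeroˡ (g (toℕ i)))) (sum-replicate-zero n)

  *ₛ-cong : ∀ {f f′ g g′} → f ≈ₛ f′ → g ≈ₛ g′ → f *ₛ g ≈ₛ f′ *ₛ g′
  *ₛ-cong f≈f′ g≈g′ k = sum-cong-≋ {suc k} (λ i → *-cong (f≈f′ (toℕ i)) (g≈g′ (k ∸ toℕ i)))

  *ₛ-congˡ : ∀ {f g g′} → g ≈ₛ g′ → f *ₛ g ≈ₛ f *ₛ g′
  *ₛ-congˡ {f} = *ₛ-cong {f} (λ _ → refl)

  *ₛ-congʳ : ∀ {f f′ g} → f ≈ₛ f′ → f *ₛ g ≈ₛ f′ *ₛ g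
  *ₛ-congʳ {g = g} f≈f′ = *ₛ-cong {g = g} f≈f′ (λ _ → refl)

  *ₛ-distribˡ : ∀ f g h → f *ₛ (g +ₛ h) ≈ₛ f *ₛ g +ₛ f *ₛ h
  *ₛ-distribˡ f g h k = trans
    (sum-cong-≋ {suc k} (λ i → distribˡ (f (toℕ i)) (g (k ∸ toℕ i)) (h (k ∸ toℕ i))))
    (∑-distrib-+ {suc k} (λ i → f (toℕ i) * g (k ∸ toℕ i)) (λ i → f (toℕ i) * h (k ∸ toℕ i)))

  *ₛ-distribʳ : ∀ f g h → (g +ₛ h) *ₛ f ≈ₛ g *ₛ f +ₛ h *ₛ f
  *ₛ-distribʳ f g h k = trans
    (sum-cong-≋ {suc k} (λ i → distribʳ (f (k ∸ toℕ i)) (g (toℕ i)) (h (toℕ i))))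
    (∑-distrib-+ {suc k} (λ i → g (toℕ i) * f (k ∸ toℕ i)) (λ i → h (toℕ i) * f (k ∸ toℕ i)))

  *ₛ-identityˡ : ∀ f → 1ₛ *ₛ f ≈ₛ f
  *ₛ-identityˡ f zero    = trans (+-identityʳ _) (*-identityˡ _)
  *ₛ-identityˡ f (suc k) = begin
    1# * f (suc k) + ∑[ i ≤ k ] (0# * f (k ∸ toℕ i))  ≈⟨ +-cong (*-identityˡ _) (∑-zeroˡ (suc k) (λ i → f (k ∸ i))) ⟩
    f (suc k) + 0#                                    ≈⟨ +-identityʳ _ ⟩
    f (suc k)                                         ∎

  *ₛ-identityʳ : ∀ f → f *ₛ 1ₛ ≈ₛ f
  *ₛ-identityʳ f zero    = trans (+-identityʳ _) (*-identityʳ _)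
  *ₛ-identityʳ f (suc k) = begin
    f 0 * 0# + ((f ∘ suc) *ₛ 1ₛ) k  ≈⟨ +-cong (zeroʳ _) (*ₛ-identityʳ (f ∘ suc) k) ⟩
    0# + f (suc k)                  ≈⟨ +-identityˡ _ ⟩
    f (suc k)                       ∎

  t·-*ₛ : ∀ f g → t· f *ₛ g ≈ₛ t· (f *ₛ g)
  t·-*ₛ f g zero    = trans (+-identityʳ _) (zeroˡ _)
  t·-*ₛ f g (suc k) = trans (+-congʳ (zeroˡ _)) (+-identityˡ _)

  -- Induction on the index, splitting off the term of `f 0`. At index 1 the tail on the right is an
  -- empty sum, at larger indices a shorter product.
  *ₛ-t· : ∀ f g → f *ₛ t· g ≈ₛ t· (f *ₛ g)
  *ₛ-t· f g zero          = trans (+-identityʳ _) (zeroʳ _)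
  *ₛ-t· f g (suc zero)    = +-congˡ (*ₛ-t· (f ∘ suc) g zero)
  *ₛ-t· f g (suc (suc k)) = +-congˡ (*ₛ-t· (f ∘ suc) g (suc k))

  [1+t]·-*ₛ : ∀ f g → [1+t]· f *ₛ g ≈ₛ [1+t]· (f *ₛ g)
  [1+t]·-*ₛ f g k = trans (*ₛ-distribʳ g f (t· f) k) (+-congˡ (t·-*ₛ f g k))

  *ₛ-[1+t]· : ∀ f g → f *ₛ [1+t]· g ≈ₛ [1+t]· (f *ₛ g)
  *ₛ-[1+t]· f g k = trans (*ₛ-distribˡ f g (t· g) k) (+-congˡ (*ₛ-t· f g k))

  t≈t·1 : t ≈ₛ t· 1ₛ
  t≈t·1 zero          = refl
  t≈t·1 (suc zero)    = refl
  t≈t·1 (suc (suc k)) = refl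

  t-*ₛ : ∀ f → t *ₛ f ≈ₛ t· f
  t-*ₛ f = ≈ₛ-trans (*ₛ-congʳ t≈t·1) (≈ₛ-trans (t·-*ₛ 1ₛ f) (t·-cong (*ₛ-identityˡ f)))

  1+t-*ₛ : ∀ f → 1+t *ₛ f ≈ₛ [1+t]· f
  1+t-*ₛ f k = trans (*ₛ-distribʳ f 1ₛ t k) (+-cong (*ₛ-identityˡ f k) (t-*ₛ f k))

  1+t^-*ₛ : ∀ n f → 1+t ^ₛ n *ₛ f ≈ₛ [1+t]^ n · f
  1+t^-*ₛ zero    f = *ₛ-identityˡ f
  1+t^-*ₛ (suc n) f =
    ≈ₛ-trans (*ₛ-congʳ (1+t-*ₛ (1+t ^ₛ n)))
    (≈ₛ-trans ([1+t]·-*ₛ (1+t ^ₛ n) f) ([1+t]·-cong (1+t^-*ₛ n f)))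

  -- Brings one factor 1 + t to the inner end, where it can cancel against an inverse.
  [1+t]^-suc : ∀ n f → [1+t]^ suc n · f ≈ₛ [1+t]^ n · [1+t]· f
  [1+t]^-suc zero    f k = refl
  [1+t]^-suc (suc n) f   = [1+t]·-cong ([1+t]^-suc n f)

  [1+t]^-cong : ∀ n {f g} → f ≈ₛ g → [1+t]^ n · f ≈ₛ [1+t]^ n · g
  [1+t]^-cong zero    f≈g = f≈g
  [1+t]^-cong (suc n) f≈g = [1+t]·-cong ([1+t]^-cong n f≈g)

  [1+t]^-*ₛ : ∀ n f g → ([1+t]^ n · f) *ₛ g ≈ₛ [1+t]^ n · (f *ₛ g)
  [1+t]^-*ₛ zero    f g k = refl
  [1+t]^-*ₛ (suc n) f g   =
    ≈ₛ-trans ([1+t]·-*ₛ ([1+t]^ n · f) g) ([1+t]·-cong ([1+t]^-*ₛ n f g))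

  *ₛ-[1+t]^ : ∀ n f g → f *ₛ ([1+t]^ n · g) ≈ₛ [1+t]^ n · (f *ₛ g)
  *ₛ-[1+t]^ zero    f g k = refl
  *ₛ-[1+t]^ (suc n) f g   =
    ≈ₛ-trans (*ₛ-[1+t]· f ([1+t]^ n · g)) ([1+t]·-cong (*ₛ-[1+t]^ n f g))

  -- Inverses of powers of 1 + t, and the series t / (1 + t)².

  [1+t]·-inverse : ∀ f → [1+t]· (1/[1+t] *ₛ f) ≈ₛ f
  [1+t]·-inverse f =
    ≈ₛ-trans (≈ₛ-sym ([1+t]·-*ₛ 1/[1+t] f))
    (≈ₛ-trans (*ₛ-congʳ inv) (*ₛ-identityˡ f))
    where
    inv : [1+t]· 1/[1+t] ≈ₛ 1ₛ
    inv = ≈ₛ-trans (≈ₛ-sym (1+t-*ₛ 1/[1+t])) 1+t-inverseʳ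

  [1+t]^-inverse : ∀ n → [1+t]^ n · (1/[1+t] ^ₛ n) ≈ₛ 1ₛ
  [1+t]^-inverse zero    k = refl
  [1+t]^-inverse (suc n)   =
    ≈ₛ-trans ([1+t]^-suc n (1/[1+t] ^ₛ suc n))
    (≈ₛ-trans ([1+t]^-cong n ([1+t]·-inverse (1/[1+t] ^ₛ n))) ([1+t]^-inverse n))

  w : Series
  w = t *ₛ 1/[1+t] ^ₛ 2

  w-*ₛ : ∀ f → w *ₛ f ≈ₛ t· (1/[1+t] ^ₛ 2 *ₛ f)
  w-*ₛ f = ≈ₛ-trans (*ₛ-congʳ (t-*ₛ (1/[1+t] ^ₛ 2))) (t·-*ₛ (1/[1+t] ^ₛ 2) f)

  -- Monomials and truncated pairings.

  monomial : ℕ → Series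
  monomial zero    = 1ₛ
  monomial (suc k) = t· monomial k

  -- The hypothesis covers m beyond the cut-off, where no monomial in the sum reaches degree m.
  ∑-monomial : ∀ N (f : ℕ → Carrier) m → (N < m → f m ≈ 0#) →
               ∑[ k ≤ N ] (f (toℕ k) * monomial (toℕ k) m) ≈ f m
  ∑-monomial zero    f zero    _ = trans (+-identityʳ _) (*-identityʳ _)
  ∑-monomial zero    f (suc m) v = begin
    f 0 * 0# + 0#  ≈⟨ +-identityʳ _ ⟩
    f 0 * 0#       ≈⟨ zeroʳ _ ⟩
    0#             ≈⟨ v z<s ⟨
    f (suc m)      ∎
  ∑-monomial (suc N) f zero    _ = begin
    f 0 * 1# + ∑[ k ≤ N ] (f (suc (toℕ k)) * 0#)
      ≈⟨ +-cong (*-identityʳ _) (trans (sum-cong-≋ {suc N} (λ k → zeroʳ (f (suc (toℕ k))))) (sum-replicate-zero (suc N))) ⟩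
    f 0 + 0#
      ≈⟨ +-identityʳ _ ⟩
    f 0 ∎
  ∑-monomial (suc N) f (suc m) v = begin
    f 0 * 0# + ∑[ k ≤ N ] (f (suc (toℕ k)) * monomial (toℕ k) m)
      ≈⟨ +-cong (zeroʳ _) (∑-monomial N (f ∘ suc) m (λ N<m → v (s<s N<m))) ⟩
    0# + f (suc m)
      ≈⟨ +-identityˡ _ ⟩
    f (suc m) ∎

  -- Both sides are the sum over 0, ..., N, peeled at opposite ends.
  ∑-shift : ∀ N (f : ℕ → Carrier) →
            f 0 + ∑[ i < N ] f (suc (toℕ i)) ≈ ∑[ i < N ] f (toℕ i) + f N
  ∑-shift zero    f = +-comm _ _
  ∑-shift (suc N) f = begin
    f 0 + (f 1 + ∑[ i < N ] f (suc (suc (toℕ i))))    ≈⟨ +-congˡ (∑-shift N (f ∘ suc)) ⟩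
    f 0 + (∑[ i < N ] f (suc (toℕ i)) + f (suc N))    ≈⟨ +-assoc _ _ _ ⟨
    f 0 + ∑[ i < N ] f (suc (toℕ i)) + f (suc N)      ∎

  -- With `g i` read as the value assigned to tⁱ, this is a linear functional of `f`, cut off after
  -- degree N.
  pairing : ℕ → Series → Series → Carrier
  pairing N f g = ∑[ i ≤ N ] (f (toℕ i) * g (toℕ i))

  pairing-cong : ∀ N {f f′ g g′} → f ≈ₛ f′ → g ≈ₛ g′ → pairing N f g ≈ pairing N f′ g′
  pairing-cong N f≈f′ g≈g′ = sum-cong-≋ {suc N} (λ i → *-cong (f≈f′ (toℕ i)) (g≈g′ (toℕ i)))

  -- Multiplication by t is adjoint to shifting `g`, as in summation by parts; the hypothesis kills
  -- the boundary term `f N * g (suc N)`.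
  pairing-t· : ∀ N f g → g (suc N) ≈ 0# → pairing N f (g ∘ suc) ≈ pairing N (t· f) g
  pairing-t· N f g g≈0 = begin
    pairing N f (g ∘ suc)
      ≈⟨ trans (+-congʳ (zeroˡ _)) (+-identityˡ _) ⟨
    0# * g 0 + pairing N f (g ∘ suc)
      ≈⟨ ∑-shift (suc N) (λ i → (t· f) i * g i) ⟩
    pairing N (t· f) g + f N * g (suc N)
      ≈⟨ +-congˡ (trans (*-congˡ g≈0) (zeroʳ _)) ⟩
    pairing N (t· f) g + 0#
      ≈⟨ +-identityʳ _ ⟩
    pairing N (t· f) g ∎

  pairing-+ˡ : ∀ N f f′ g → pairing N (f +ₛ f′) g ≈ pairing N f g + pairing N f′ g
  pairing-+ˡ N f f′ g = trans
    (sum-cong-≋ {suc N} (λ i → distribʳ (g (toℕ i)) (f (toℕ i)) (f′ (toℕ i))))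
    (∑-distrib-+ {suc N} (λ i → f (toℕ i) * g (toℕ i)) (λ i → f′ (toℕ i) * g (toℕ i)))

  pairing-+ʳ : ∀ N f g g′ → pairing N f (g +ₛ g′) ≈ pairing N f g + pairing N f g′
  pairing-+ʳ N f g g′ = trans
    (sum-cong-≋ {suc N} (λ i → distribˡ (f (toℕ i)) (g (toℕ i)) (g′ (toℕ i))))
    (∑-distrib-+ {suc N} (λ i → f (toℕ i) * g (toℕ i)) (λ i → f (toℕ i) * g′ (toℕ i)))

  pairing-[1+t]· : ∀ N f g → g (suc N) ≈ 0# →
    pairing N f (g +ₛ g ∘ suc) ≈ pairing N ([1+t]· f) g
  pairing-[1+t]· N f g g≈0 = begin
    pairing N f (g +ₛ g ∘ suc)             ≈⟨ pairing-+ʳ N f g (g ∘ suc) ⟩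
    pairing N f g + pairing N f (g ∘ suc)  ≈⟨ +-congˡ (pairing-t· N f g g≈0) ⟩
    pairing N f g + pairing N (t· f) g     ≈⟨ pairing-+ˡ N f (t· f) g ⟨
    pairing N ([1+t]· f) g                 ∎

  -- Substitution of C̃ for t.

  ballotₛ : ℕ → Series
  ballotₛ m i = ballot i m · 1#

  ballotₛ-suc : ∀ m i → ballotₛ (suc m) (suc i) ≈
    (ballotₛ m i + ballotₛ m (suc i)) + (ballotₛ m (suc i) + ballotₛ m (suc (suc i)))
  ballotₛ-suc m i = trans
    (×-homo-+ 1# (ballot i m ℕ.+ ballot (suc i) m) _)
    (+-cong (×-homo-+ 1# (ballot i m) _) (×-homo-+ 1# (ballot (suc i) m) _))

  ballotₛ-vanishes : ∀ {m i} → m < i → ballotₛ m i ≈ 0#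
  ballotₛ-vanishes m<i = ×-congˡ (ballot-vanishes m<i)

  -- [uᵐ] f(C̃(u)), as C̃ⁱ starts in degree i.
  atC̃ : Series → Series
  atC̃ f m = pairing m f (ballotₛ m)

  -- This encodes C̃ = u (1 + C̃)². The recurrence of `ballot` applies identity plus shift twice to
  -- the values of the powers of t, and each application is adjoint to multiplication by 1 + t.
  atC̃-t· : ∀ f m → atC̃ (t· f) (suc m) ≈ atC̃ ([1+t]^ 2 · f) m
  atC̃-t· f m = begin
    0# * _ + pairing m f (ballotₛ (suc m) ∘ suc)
      ≈⟨ trans (+-congʳ (zeroˡ _)) (+-identityˡ _) ⟩
    pairing m f (ballotₛ (suc m) ∘ suc)
      ≈⟨ pairing-cong m {f} (λ _ → refl) (ballotₛ-suc m) ⟩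
    pairing m f (g +ₛ g ∘ suc)
      -- The boundary value is the sum of the entries at m + 1 and m + 2, both zero because C̃ⁱ
      -- starts in degree i.
      ≈⟨ pairing-[1+t]· m f g (trans (+-cong (ballotₛ-vanishes {m} (ℕ.n<1+n m)) (ballotₛ-vanishes {m} (ℕ.m<n⇒m<1+n (ℕ.n<1+n m)))) (+-identityʳ 0#)) ⟩
    pairing m ([1+t]· f) g
      ≈⟨ pairing-[1+t]· m ([1+t]· f) (ballotₛ m) (ballotₛ-vanishes {m} (ℕ.n<1+n m)) ⟩
    atC̃ ([1+t]^ 2 · f) m ∎
    where
    g : Series
    g = ballotₛ m +ₛ ballotₛ m ∘ suc

  atC̃-cong : ∀ {f g} → f ≈ₛ g → atC̃ f ≈ₛ atC̃ g
  atC̃-cong f≈g m = pairing-cong m {g = ballotₛ m} f≈g (λ _ → refl)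

  -- The next power of `w` is `t· f` with (1 + t)² f = wᵏ: the factor t becomes u, and the
  -- denominator cancels before substituting.
  atC̃-w^ : ∀ k → atC̃ (w ^ₛ k) ≈ₛ monomial k
  atC̃-w^ zero zero = trans (+-identityʳ _) (trans (*-identityˡ _) (×-homo-1 1#))
  atC̃-w^ zero (suc m) = begin
    1# * 0# + ∑[ i ≤ m ] (0# * ballotₛ (suc m) (suc (toℕ i)))
      ≈⟨ +-cong (zeroʳ 1#) (∑-zeroˡ (suc m) (ballotₛ (suc m) ∘ suc)) ⟩
    0# + 0#
      ≈⟨ +-identityʳ 0# ⟩
    0# ∎
  atC̃-w^ (suc k) m = trans (atC̃-cong (w-*ₛ (w ^ₛ k)) m) (shifted m)
    where
    f : Series
    f = 1/[1+t] ^ₛ 2 *ₛ w ^ₛ k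
    [1+t]²f≈w^k : [1+t]^ 2 · f ≈ₛ w ^ₛ k
    [1+t]²f≈w^k =
      ≈ₛ-trans (≈ₛ-sym ([1+t]^-*ₛ 2 (1/[1+t] ^ₛ 2) (w ^ₛ k)))
      (≈ₛ-trans (*ₛ-congʳ ([1+t]^-inverse 2)) (*ₛ-identityˡ (w ^ₛ k)))
    shifted : atC̃ (t· f) ≈ₛ t· monomial k
    shifted zero    = trans (+-identityʳ _) (zeroˡ _)
    shifted (suc m) = begin
      atC̃ (t· f) (suc m)      ≈⟨ atC̃-t· f m ⟩
      atC̃ ([1+t]^ 2 · f) m    ≈⟨ atC̃-cong [1+t]²f≈w^k m ⟩
      atC̃ (w ^ₛ k) m          ≈⟨ atC̃-w^ k m ⟩
      monomial k m            ∎

  -- By linearity: exchanging the two finite sums reduces the claim to powers of `w`.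
  atC̃-⟨w⟩ : ∀ γ → atC̃ (γ ⟨ w ⟩) ≈ₛ coeff γ
  atC̃-⟨w⟩ γ m = begin
    ∑[ i ≤ m ] ((γ ⟨ w ⟩) (toℕ i) * b (toℕ i))
      ≈⟨ sum-cong-≋ {suc m} (λ i → *-distribʳ-sum {suc N} (b (toℕ i)) (λ k → a (toℕ k) * (w ^ₛ toℕ k) (toℕ i))) ⟩
    ∑[ i ≤ m ] (∑[ k ≤ N ] (a (toℕ k) * (w ^ₛ toℕ k) (toℕ i) * b (toℕ i)))
      ≈⟨ ∑-comm {suc m} {suc N} (λ i k → a (toℕ k) * (w ^ₛ toℕ k) (toℕ i) * b (toℕ i)) ⟩
    ∑[ k ≤ N ] (∑[ i ≤ m ] (a (toℕ k) * (w ^ₛ toℕ k) (toℕ i) * b (toℕ i)))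
      ≈⟨ sum-cong-≋ {suc N} (λ k → factor (a (toℕ k)) (w ^ₛ toℕ k)) ⟩
    ∑[ k ≤ N ] (a (toℕ k) * atC̃ (w ^ₛ toℕ k) m)
      ≈⟨ sum-cong-≋ {suc N} (λ k → *-congˡ {a (toℕ k)} (atC̃-w^ (toℕ k) m)) ⟩
    ∑[ k ≤ N ] (a (toℕ k) * monomial (toℕ k) m)
      ≈⟨ ∑-monomial N a m (vanishes γ m) ⟩
    coeff γ m ∎
    where
    N = bound γ
    a = coeff γ
    b = ballotₛ m
    factor : ∀ x f → ∑[ i ≤ m ] (x * f (toℕ i) * b (toℕ i)) ≈ x * atC̃ f m
    factor x f = trans
      (sum-cong-≋ {suc m} (λ i → *-assoc x (f (toℕ i)) (b (toℕ i))))
      (sym (*-distribˡ-sum {suc m} x (λ i → f (toℕ i) * b (toℕ i))))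

  -- Signs and the binomial series of (1 + t)^-n.

  fromℤ-neg : ∀ i → fromℤ (ℤ.- i) ≈ - fromℤ i
  fromℤ-neg (+ zero)   = sym ε⁻¹≈ε
  fromℤ-neg (+ suc n)  = refl
  fromℤ-neg (-[1+ n ]) = sym (⁻¹-involutive _)

  sign : ℕ → Carrier
  sign k = fromℤ (ℤ.-1ℤ ℤ.^ k)

  sign-suc : ∀ k → sign (suc k) ≈ - sign k
  sign-suc k = trans
    (reflexive (≡.cong fromℤ (ℤ.-1*i≡-i (ℤ.-1ℤ ℤ.^ k))))
    (fromℤ-neg (ℤ.-1ℤ ℤ.^ k))

  -- Multiplicativity of `fromℤ` when one factor is a power of -1, where each induction step is a
  -- mere negation.
  fromℤ-sign-* : ∀ k i → fromℤ (ℤ.-1ℤ ℤ.^ k ℤ.* i) ≈ sign k * fromℤ i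
  fromℤ-sign-* zero    i = begin
    fromℤ (ℤ.1ℤ ℤ.* i)  ≡⟨ ≡.cong fromℤ (ℤ.*-identityˡ i) ⟩
    fromℤ i             ≈⟨ *-identityˡ _ ⟨
    1# * fromℤ i        ≈⟨ *-congʳ (×-homo-1 1#) ⟨
    sign 0 * fromℤ i    ∎
  fromℤ-sign-* (suc k) i = begin
    fromℤ (ℤ.-1ℤ ℤ.* s ℤ.* i)  ≡⟨ ≡.cong fromℤ (≡.trans (ℤ.*-assoc ℤ.-1ℤ s i) (ℤ.-1*i≡-i (s ℤ.* i))) ⟩
    fromℤ (ℤ.- (s ℤ.* i))      ≈⟨ fromℤ-neg (s ℤ.* i) ⟩
    - fromℤ (s ℤ.* i)          ≈⟨ -‿cong (fromℤ-sign-* k i) ⟩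
    - (sign k * fromℤ i)       ≈⟨ -‿distribˡ-* _ _ ⟩
    - sign k * fromℤ i         ≈⟨ *-congʳ (sign-suc k) ⟨
    sign (suc k) * fromℤ i     ∎
    where s = ℤ.-1ℤ ℤ.^ k

  binomialₛ : ℕ → Series
  binomialₛ n k = sign k * fromℤ (+ multichoose n k)

  -- In each positive degree the alternating signs cancel one summand of the recurrence of
  -- `multichoose` against the shifted term.
  binomialₛ-pascal : ∀ n → [1+t]· binomialₛ (suc n) ≈ₛ binomialₛ n
  binomialₛ-pascal n zero    = +-identityʳ _
  binomialₛ-pascal n (suc k) = begin
    sign (suc k) * ((multichoose (suc n) k ℕ.+ multichoose n (suc k)) · 1#) + sign k * a
      ≈⟨ +-congʳ (*-congˡ (×-homo-+ 1# (multichoose (suc n) k) _)) ⟩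
    sign (suc k) * (a + b) + sign k * a
      ≈⟨ +-congʳ (trans (distribˡ _ _ _) (+-comm _ _)) ⟩
    (sign (suc k) * b + sign (suc k) * a) + sign k * a
      ≈⟨ +-assoc _ _ _ ⟩
    sign (suc k) * b + (sign (suc k) * a + sign k * a)
      ≈⟨ +-congˡ (distribʳ a _ _) ⟨
    sign (suc k) * b + (sign (suc k) + sign k) * a
      ≈⟨ +-congˡ (*-congʳ (trans (+-congʳ (sign-suc k)) (-‿inverseˡ _))) ⟩
    sign (suc k) * b + 0# * a
      ≈⟨ trans (+-congˡ (zeroˡ a)) (+-identityʳ _) ⟩
    sign (suc k) * b ∎
    where
    a = multichoose (suc n) k · 1#
    b = multichoose n (suc k) · 1#

  [1+t]^-binomialₛ : ∀ n → [1+t]^ n · binomialₛ n ≈ₛ 1ₛ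
  [1+t]^-binomialₛ zero    zero    = trans (*-cong (×-homo-1 1#) (×-homo-1 1#)) (*-identityˡ 1#)
  [1+t]^-binomialₛ zero    (suc k) = zeroʳ _
  [1+t]^-binomialₛ (suc n)         =
    ≈ₛ-trans ([1+t]^-suc n (binomialₛ (suc n)))
    (≈ₛ-trans ([1+t]^-cong n (binomialₛ-pascal n)) ([1+t]^-binomialₛ n))

  -- Division by (1 + t)ⁿ: the power, as an operator, is moved from the left factor onto
  -- `binomialₛ n`, which it turns into 1.
  *ₛ-binomialₛ : ∀ n {f g} → f ≈ₛ 1+t ^ₛ n *ₛ g → f *ₛ binomialₛ n ≈ₛ g
  *ₛ-binomialₛ n {f} {g} f≈ =
    ≈ₛ-trans (*ₛ-congʳ (≈ₛ-trans f≈ (1+t^-*ₛ n g)))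
    (≈ₛ-trans ([1+t]^-*ₛ n g (binomialₛ n))
    (≈ₛ-trans (≈ₛ-sym (*ₛ-[1+t]^ n g (binomialₛ n)))
    (≈ₛ-trans (*ₛ-congˡ {g} ([1+t]^-binomialₛ n)) (*ₛ-identityʳ g))))

  -- The two gamma sums.

  fromℤ-binomial-neg : ∀ n k → fromℤ (binomial (ℤ.- + n) k) ≈ binomialₛ n k
  fromℤ-binomial-neg n k = trans
    (reflexive (≡.cong fromℤ (binomial-neg n k)))
    (fromℤ-sign-* k (+ multichoose n k))

  -- The Catalan factor depends on i alone, so it leaves the sum over l; what is left there is the
  -- coefficient of tⁱ in (1 + t)^-n h(t).
  gammaSum≈atC̃ : ∀ n h → gammaSum n h ≈ₛ atC̃ (coeff h *ₛ binomialₛ n)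
  gammaSum≈atC̃ n h m = sum-cong-≋ {suc m} (λ i → row (toℕ i))
    where
    catalanSum≈ballot : ∀ i → fromℤ (+ catalanSum i m) ≈ ballotₛ m i
    catalanSum≈ballot i = ×-congˡ {1#} (catalanSum≡ballot i m)
    row : ∀ i →
      ∑[ l ≤ i ] (coeff h (toℕ l) * fromℤ (binomial (ℤ.- + n) (i ∸ toℕ l)) * fromℤ (+ catalanSum i m)) ≈
      (coeff h *ₛ binomialₛ n) i * ballotₛ m i
    row i = trans
      (sum-cong-≋ {suc i} λ l →
        *-cong (*-congˡ {coeff h (toℕ l)} (fromℤ-binomial-neg n (i ∸ toℕ l)))
               (catalanSum≈ballot i))
      (sym (*-distribʳ-sum {suc i} (ballotₛ m i) (λ l → coeff h (toℕ l) * binomialₛ n (i ∸ toℕ l))))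

  gammaSum≈gammaSum′ : ∀ n h → gammaSum n h ≈ₛ gammaSum′ n h
  gammaSum≈gammaSum′ n h m =
    sum-cong-≋ {suc m} λ i → sum-cong-≋ {suc (toℕ i)} λ l →
      -- The range of l provides l ≤ i, which makes `i ∸ l` agree with the integer difference in the
      -- upper index.
      *-congʳ {fromℤ (+ catalanSum (toℕ i) m)} (summand (toℕ i) (toℕ l) (toℕ≤pred[n] l))
    where
    summand : ∀ i l → l ≤ i →
      coeff h l * fromℤ (binomial (ℤ.- + n) (i ∸ l)) ≈
      coeff h l * sign (i ∸ l) * fromℤ (binomial (+ n ℤ.+ + i ℤ.- + l ℤ.- + 1) (i ∸ l))
    summand i l l≤i = begin
      coeff h l * fromℤ (binomial (ℤ.- + n) (i ∸ l))
        ≈⟨ *-congˡ (fromℤ-binomial-neg n (i ∸ l)) ⟩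
      coeff h l * (sign (i ∸ l) * fromℤ (+ multichoose n (i ∸ l)))
        ≈⟨ *-assoc _ _ _ ⟨
      coeff h l * sign (i ∸ l) * fromℤ (+ multichoose n (i ∸ l))
        ≡⟨ ≡.cong (λ z → coeff h l * sign (i ∸ l) * fromℤ z) upper ⟨
      coeff h l * sign (i ∸ l) * fromℤ (binomial (+ n ℤ.+ + i ℤ.- + l ℤ.- + 1) (i ∸ l)) ∎
      where
      top : + n ℤ.+ + i ℤ.- + l ≡ + n ℤ.+ + (i ∸ l)
      top = ≡.trans (ℤ.+-assoc (+ n) (+ i) (ℤ.- + l))
        (≡.cong (ℤ._+_ (+ n)) (≡.trans (ℤ.m-n≡m⊖n i l) (ℤ.⊖-≥ l≤i)))
      upper : binomial (+ n ℤ.+ + i ℤ.- + l ℤ.- + 1) (i ∸ l) ≡ + multichoose n (i ∸ l)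
      upper = ≡.trans
        (≡.cong (λ x → binomial (x ℤ.- + 1) (i ∸ l)) top)
        (binomial-pos n (i ∸ l))

  gammaSum≈coeff : ∀ n h γ → coeff h ≈ₛ 1+t ^ₛ n *ₛ γ ⟨ w ⟩ → gammaSum n h ≈ₛ coeff γ
  gammaSum≈coeff n h γ h≈ =
    ≈ₛ-trans (gammaSum≈atC̃ n h)
    (≈ₛ-trans (atC̃-cong (*ₛ-binomialₛ n h≈)) (atC̃-⟨w⟩ γ))

theorem1p1 : ∀ {c ℓ} (R : CommutativeRing c ℓ) →
    let open CommutativeRing R in
    let open GammaPolynomial R in
    (n : ℕ) (h : Polynomial) → HasDegree n h → Reciprocal n h →
    (γ : Polynomial) → IsGammaPolynomial n h γ →
    (∀ m → (coeff γ m ≈ gammaSum n h m) × (gammaSum n h m ≈ gammaSum′ n h m)) ×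
    (∀ m → ⌊ n /2⌋ < m → gammaSum n h m ≈ 0#)
theorem1p1 R n h _ _ γ (γ-degree , h≈) =
  (λ m → sym (gammaSum≈coeff n h γ h≈ m) , gammaSum≈gammaSum′ n h m) ,
  -- Beyond half of n the sum still equals the coefficient of γ, which is zero by the degree bound.
  (λ m n/2<m → trans (gammaSum≈coeff n h γ h≈ m) (γ-degree m n/2<m))
  where
  open CommutativeRing R using (sym; trans)
  open PowerSeries R
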